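{- For every integer $n>1$, $A(2^n+1)=2^n+2$.
   Context: Let $\theta$ be the Thue--Morse substitution on the alphabet $\{0,1\}$, $\theta\colon 0\mapsto 01,\ 1\mapsto 10$ (extended to words by concatenation), and let $v=v_0v_1v_2\dots=\lim_{n\to\infty}\theta^n(0)\in\{0,1\}^{\mathbb{N}}$ be the Thue--Morse word, indexed from $0$. For positive integers $d,L$, a monochromatic arithmetic progression of difference $d$ and length $L$ in $v$ means that there is $i\ge 0$ with $v_i=v_{i+d}=v_{i+2d}=\dots=v_{i+(L-1)d}$. For a positive integer $d$, $A(d)$ denotes the maximum length $L$ of a monochromatic arithmetic progression of difference $d$ in $v$ (this maximum exists and is finite for every $d$). -}

module Defs where

open import Data.Fin.Base using (Fin; fromℕ<)
open import Data.Fin.Patterns using (0F; 1F)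
open import Data.List.Base using (List; []; _∷_; [_]; length; lookup; concatMap)
open import Data.List.Relation.Binary.Prefix.Heterogeneous using (Prefix; []; _∷_)
open import Data.Nat.Base
  using (ℕ; zero; suc; _+_; _*_; _≤_; _<_; z≤n; s≤s; s<s⁻¹)
open import Data.Nat.GeneralisedArithmetic using (fold)
open import Data.Nat.Properties
  using (≤-antisym; ≤-trans; ≤-total; +-mono-≤; +-suc)
open import Data.Product.Base using (_×_; _,_; ∃-syntax)
open import Data.Sum.Base using (inj₁; inj₂)
open import Relation.Binary.PropositionalEquality
  using (_≡_; refl; sym; trans; cong; subst)

Letter : Set
Letter = Fin 2

Word : Set
Word = List Letter

θ : Letter → Word
θ 0F = 0F ∷ 1F ∷ []
θ 1F = 1F ∷ 0F ∷ []

θ* : Word → Word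
θ* = concatMap θ

θ^ : ℕ → Word → Word
θ^ n w = fold w θ* n

length-θ* : ∀ w → length (θ* w) ≡ length w + length w
length-θ* []       = refl
length-θ* (0F ∷ w) = cong suc (trans (cong suc (length-θ* w)) (sym (+-suc (length w) (length w))))
length-θ* (1F ∷ w) = cong suc (trans (cong suc (length-θ* w)) (sym (+-suc (length w) (length w))))

n<length-θ^ : ∀ n → n < length (θ^ n [ 0F ])
n<length-θ^ zero    = s≤s z≤n
n<length-θ^ (suc n) = subst (suc n <_) (sym (length-θ* (θ^ n [ 0F ])))
  (+-mono-≤ (≤-trans (s≤s z≤n) (n<length-θ^ n)) (n<length-θ^ n))

-- The iterates θ^ n [ 0F ] are prefixes of one another, so any iterate longer
-- than i determines the letter at position i of the limit; see v-limit.
v : ℕ → Letter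
v i = lookup (θ^ i [ 0F ]) (fromℕ< (n<length-θ^ i))

_⊑_ : Word → Word → Set
_⊑_ = Prefix _≡_

⊑-refl : ∀ w → w ⊑ w
⊑-refl []      = []
⊑-refl (a ∷ w) = refl ∷ ⊑-refl w

⊑-θ* : ∀ {u w} → u ⊑ w → θ* u ⊑ θ* w
⊑-θ* []                = []
⊑-θ* (_∷_ {0F} refl p) = refl ∷ refl ∷ ⊑-θ* p
⊑-θ* (_∷_ {1F} refl p) = refl ∷ refl ∷ ⊑-θ* p

[0]⊑θ^ : ∀ n → [ 0F ] ⊑ θ^ n [ 0F ]
[0]⊑θ^ zero    = ⊑-refl [ 0F ]
[0]⊑θ^ (suc n) with θ^ n [ 0F ] | [0]⊑θ^ n
... | _ | refl ∷ [] = refl ∷ []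

θ^-mono : ∀ {m n} → m ≤ n → θ^ m [ 0F ] ⊑ θ^ n [ 0F ]
θ^-mono {n = n} z≤n = [0]⊑θ^ n
θ^-mono (s≤s m≤n)   = ⊑-θ* (θ^-mono m≤n)

lookup-⊑ : ∀ {u w i} → u ⊑ w → (p : i < length u) (q : i < length w) →
           lookup u (fromℕ< p) ≡ lookup w (fromℕ< q)
lookup-⊑ {i = zero}  (refl ∷ _) _ _ = refl
lookup-⊑ {i = suc i} (_ ∷ u⊑w)  p q = lookup-⊑ u⊑w (s<s⁻¹ p) (s<s⁻¹ q)

v-limit : ∀ n {i} (i<len : i < length (θ^ n [ 0F ])) →
          lookup (θ^ n [ 0F ]) (fromℕ< i<len) ≡ v i
v-limit n {i} i<len with ≤-total n i
... | inj₁ n≤i = lookup-⊑ (θ^-mono n≤i) i<len (n<length-θ^ i)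
... | inj₂ i≤n = sym (lookup-⊑ (θ^-mono i≤n) (n<length-θ^ i) i<len)

MonochromaticAP : (d L : ℕ) → Set
MonochromaticAP d L = ∃[ i ] (∀ k → k < L → v (i + k * d) ≡ v i)

-- The function A is given by its graph: A[ d ]= L says that L is the maximum
-- of the lengths of monochromatic progressions of difference d.  For d = 0
-- there is no such L.
A[_]=_ : (d L : ℕ) → Set
A[ d ]= L = (1 ≤ L × MonochromaticAP d L)
          × (∀ L′ → 1 ≤ L′ → MonochromaticAP d L′ → L′ ≤ L)

A-functional : ∀ {d L M} → A[ d ]= L → A[ d ]= M → L ≡ M
A-functional ((1≤L , apL) , maxL) ((1≤M , apM) , maxM) =
  ≤-antisym (maxM _ 1≤L apL) (maxL _ 1≤M apM)

-- For N = 2 ^ n and r < N one has t (r + q N) = t r + t q mod 2.  Along a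
-- progression of difference N + 1 both r and q grow by one, except that q
-- skips a value when r wraps around to 0, so constancy means that the word
-- around q repeats, up to complement, a suffix of θⁿ(0) and then, after the
-- skipped letter, a prefix of it.  Two equal adjacent letters of the
-- Thue–Morse word start at an odd position, so if at least three terms precede
-- the skip, then the two parts require different parities of q.  If the skip
-- comes after one or two terms, the few terms before it and those after the
-- next skip determine q modulo 4, and the letters in between exclude that
-- residue.
module Submission where

open import Defs
open import Data.Bool.Base using (Bool; true; false; not; _xor_)
open import Data.Bool.Properties using (not-injective; not-¬; not-distribˡ-xor; not-involutive)
open import Data.Empty using (⊥; ⊥-elim)
open import Data.Fin.Base using (fromℕ<)
open import Data.Fin.Patterns using (0F; 1F)
open import Data.Fin.Properties using (2↔Bool)
open import Data.List.Base using ([]; _∷_; [_]; length; lookup)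
open import Data.Nat.Base
  using (ℕ; zero; suc; _+_; _∸_; _*_; _^_; _≤_; _<_; _>_; s≤s; s≤s⁻¹; s<s⁻¹)
open import Data.Nat.DivMod using (_/_; _%_; m≡m%n+[m/n]*n; m%n<n)
open import Data.Nat.Properties
open import Data.Nat.Tactic.RingSolver using (solve)
open import Data.Product.Base using (_,_; ∃-syntax)
open import Data.Sum.Base using (_⊎_; inj₁; inj₂)
open import Function.Bundles using (Inverse)
open import Relation.Binary.PropositionalEquality
  using (_≡_; _≢_; refl; sym; trans; cong; subst; subst₂; module ≡-Reasoning)

-- Letters as Booleans and the binary recurrences of the word

bit : Letter → Bool
bit = Inverse.to 2↔Bool

t : ℕ → Bool
t i = bit (v i)

bit-injective : ∀ {a b} → bit a ≡ bit b → a ≡ b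
bit-injective {0F} {0F} _ = refl
bit-injective {0F} {1F} ()
bit-injective {1F} {0F} ()
bit-injective {1F} {1F} _ = refl

lookup-θ*-even : ∀ w {i} (p : i < length w) (q : i * 2 < length (θ* w)) →
                 lookup (θ* w) (fromℕ< q) ≡ lookup w (fromℕ< p)
lookup-θ*-even (0F ∷ w) {zero}  _ _ = refl
lookup-θ*-even (1F ∷ w) {zero}  _ _ = refl
lookup-θ*-even (0F ∷ w) {suc i} p q = lookup-θ*-even w (s<s⁻¹ p) (s<s⁻¹ (s<s⁻¹ q))
lookup-θ*-even (1F ∷ w) {suc i} p q = lookup-θ*-even w (s<s⁻¹ p) (s<s⁻¹ (s<s⁻¹ q))

lookup-θ*-odd : ∀ w {i} (p : i < length w) (q : suc (i * 2) < length (θ* w)) →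
                bit (lookup (θ* w) (fromℕ< q)) ≡ not (bit (lookup w (fromℕ< p)))
lookup-θ*-odd (0F ∷ w) {zero}  _ _ = refl
lookup-θ*-odd (1F ∷ w) {zero}  _ _ = refl
lookup-θ*-odd (0F ∷ w) {suc i} p q = lookup-θ*-odd w (s<s⁻¹ p) (s<s⁻¹ (s<s⁻¹ q))
lookup-θ*-odd (1F ∷ w) {suc i} p q = lookup-θ*-odd w (s<s⁻¹ p) (s<s⁻¹ (s<s⁻¹ q))

1+i*2<length-θ* : ∀ w {i} → i < length w → suc (i * 2) < length (θ* w)
1+i*2<length-θ* w {i} i<w = begin
  suc (suc (i * 2))     ≡⟨ solve (i ∷ []) ⟩
  suc i + suc i         ≤⟨ +-mono-≤ i<w i<w ⟩
  length w + length w   ≡⟨ length-θ* w ⟨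
  length (θ* w)         ∎
  where open ≤-Reasoning

-- `v-limit` allows position `i * 2` to be read in iterate `suc i`, which is `θ*` of the very
-- iterate that defines `v i`.
t-even : ∀ i → t (i * 2) ≡ t i
t-even i = cong bit (trans
  (sym (v-limit (suc i) i*2<))
  (lookup-θ*-even (θ^ i [ 0F ]) (n<length-θ^ i) i*2<))
  where i*2< = <-trans (n<1+n _) (1+i*2<length-θ* (θ^ i [ 0F ]) (n<length-θ^ i))

t-odd : ∀ i → t (1 + i * 2) ≡ not (t i)
t-odd i = trans
  (cong bit (sym (v-limit (suc i) 1+i*2<)))
  (lookup-θ*-odd (θ^ i [ 0F ]) (n<length-θ^ i) 1+i*2<)
  where 1+i*2< = 1+i*2<length-θ* (θ^ i [ 0F ]) (n<length-θ^ i)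

-- Splitting an index at a power of two

parity : ∀ n → (∃[ k ] n ≡ k * 2) ⊎ (∃[ k ] n ≡ 1 + k * 2)
parity zero = inj₁ (0 , refl)
parity (suc n) with parity n
... | inj₁ (k , refl) = inj₂ (k , refl)
... | inj₂ (k , refl) = inj₁ (suc k , refl)

-- Induction on `n` strips the lowest binary digit of `r`, which is also that of the whole index;
-- `t-even` and `t-odd` then change both sides alike.
t-split : ∀ n r q → r < 2 ^ n → t (r + q * 2 ^ n) ≡ t r xor t q
t-split zero zero q _ = cong t (*-identityʳ q)
t-split zero (suc r) q (s≤s ())
t-split (suc n) r q r< with parity r
... | inj₁ (s , refl) = begin
  t (s * 2 + q * (2 * 2 ^ n))  ≡⟨ cong t (eq (2 ^ n)) ⟩
  t ((s + q * 2 ^ n) * 2)      ≡⟨ t-even (s + q * 2 ^ n) ⟩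
  t (s + q * 2 ^ n)            ≡⟨ t-split n s q s< ⟩
  t s xor t q                  ≡⟨ cong (_xor t q) (t-even s) ⟨
  t (s * 2) xor t q            ∎
  where
  open ≡-Reasoning
  s< : s < 2 ^ n
  s< = *-cancelʳ-< 2 s (2 ^ n) (subst (s * 2 <_) (*-comm 2 (2 ^ n)) r<)
  eq : ∀ N → s * 2 + q * (2 * N) ≡ (s + q * N) * 2
  eq N = solve (s ∷ q ∷ N ∷ [])
... | inj₂ (s , refl) = begin
  t (1 + s * 2 + q * (2 * 2 ^ n))  ≡⟨ cong t (eq (2 ^ n)) ⟩
  t (1 + (s + q * 2 ^ n) * 2)      ≡⟨ t-odd (s + q * 2 ^ n) ⟩
  not (t (s + q * 2 ^ n))          ≡⟨ cong not (t-split n s q s<) ⟩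
  not (t s xor t q)                ≡⟨ not-distribˡ-xor (t s) (t q) ⟩
  not (t s) xor t q                ≡⟨ cong (_xor t q) (t-odd s) ⟨
  t (1 + s * 2) xor t q            ∎
  where
  open ≡-Reasoning
  s< : s < 2 ^ n
  s< = *-cancelʳ-< 2 s (2 ^ n)
    (<-trans (n<1+n _) (subst (1 + s * 2 <_) (*-comm 2 (2 ^ n)) r<))
  eq : ∀ N → 1 + s * 2 + q * (2 * N) ≡ 1 + (s + q * N) * 2
  eq N = solve (s ∷ q ∷ N ∷ [])

-- The two positions carry one block `θ a`, whose letters differ. Each wrap position in the upper
-- bound is refuted by producing an equal pair of this kind.
t-even-pair : ∀ y → t (y * 2) ≢ t (1 + y * 2)
t-even-pair y eq = not-¬ {t y} refl (trans (sym (t-even y)) (trans eq (t-odd y)))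

xor-cancelˡ : ∀ a {b c} → a xor b ≡ a xor c → b ≡ c
xor-cancelˡ false eq = eq
xor-cancelˡ true  eq = not-injective eq

xor-cancelˡ-not : ∀ a {b c} → a xor b ≡ not a xor c → b ≡ not c
xor-cancelˡ-not false eq = eq
xor-cancelˡ-not true  eq = trans (sym (not-involutive _)) (cong not eq)

xor-xor-cancelˡ : ∀ a b → a xor (a xor b) ≡ b
xor-xor-cancelˡ false b = refl
xor-xor-cancelˡ true  b = not-involutive b

-- Upper bound: quotients and remainders along a progression

SplitsAt : ℕ → Set
SplitsAt N = ∀ r q → r < N → t (r + q * N) ≡ t r xor t q

-- The remainder wraps around at the steps s = N ∸ r and s + N.
module Readings (N r s q : ℕ) (c : Bool) (s+r≡N : s + r ≡ N) (split : SplitsAt N)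
  (long : ∀ k → k < 3 + N → t (r + q * N + k * (1 + N)) ≡ c) where

  reading : ∀ k r′ q′ → k < 3 + N → r′ < N →
            r + q * N + k * (1 + N) ≡ r′ + q′ * N → t r′ xor t q′ ≡ c
  reading k r′ q′ k< r′< eq =
    trans (sym (split r′ q′ r′<)) (trans (cong t (sym eq)) (long k k<))

  before-wrap : ∀ k → k + r < N → t (k + r) xor t (k + q) ≡ c
  before-wrap k k+r<N = reading k (k + r) (k + q)
    (≤-trans (s≤s (m≤m+n k r)) (≤-trans k+r<N (m≤n+m N 3))) k+r<N
    (solve (r ∷ q ∷ k ∷ N ∷ []))

  -- Step `s - 1` has quotient `q + s - 1` and step `s` has `q + s + 1`: the leading `1` accounts
  -- for the skipped value.
  after-wrap : ∀ j → j < N → j + s < 3 + N → t j xor t (1 + (j + s + q)) ≡ c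
  after-wrap j j<N j+s< = reading (j + s) j (1 + (j + s + q)) j+s< j<N (eq s+r≡N)
    where
    eq : ∀ {M} → s + r ≡ M →
         r + q * M + (j + s) * (1 + M) ≡ j + (1 + (j + s + q)) * M
    eq refl = solve (r ∷ s ∷ q ∷ j ∷ [])

  -- Only `3 + N` steps are available, so at most `3 - s` terms lie here: two for `s = 1`, one for
  -- `s = 2`, none beyond.
  after-second-wrap : ∀ j → j < N → j + s < 3 → t j xor t (2 + (j + s + (N + q))) ≡ c
  after-second-wrap j j<N j+s<3 =
    reading (j + s + N) j (2 + (j + s + (N + q))) (+-monoˡ-< N j+s<3) j<N (eq s+r≡N)
    where
    eq : ∀ {M} → s + r ≡ M →
         r + q * M + (j + s + M) * (1 + M) ≡ j + (2 + (j + s + (M + q))) * M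
    eq refl = solve (r ∷ s ∷ q ∷ j ∷ [])

module _ (m q : ℕ) (c : Bool) (split : SplitsAt (4 + m * 2 * 2)) where

  -- With `N = 4 + m * 2 * 2`, this is `3 + N` terms of difference `1 + N`, one term more than the
  -- maximum. The factors `2` are those that `t-even` and `t-odd` remove.
  Long : ℕ → Set
  Long r = ∀ k → k < 7 + m * 2 * 2 →
           t (r + q * (4 + m * 2 * 2) + k * (5 + m * 2 * 2)) ≡ c

  -- The letters 0, 1, 1 at positions 0, 1, 2 force q + s to be odd, and
  -- the letters at N ∸ 3 and N ∸ 2, which are equal, force it to be even.
  wrap-not-at-3+ : ∀ u r → 3 + u + r ≡ 4 + m * 2 * 2 → Long r → ⊥
  wrap-not-at-3+ u r s+r≡N long = by-parity (u + q) (parity (u + q)) before after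
    where
    open Readings (4 + m * 2 * 2) r (3 + u) q c s+r≡N split long

    u+r≡ : u + r ≡ 1 + m * 2 * 2
    u+r≡ = suc-injective (suc-injective (suc-injective s+r≡N))

    3+u≤N : 3 + u ≤ 4 + m * 2 * 2
    3+u≤N = ≤-trans (m≤m+n (3 + u) r) (≤-reflexive s+r≡N)

    -- The last four letters before `N` form a block `θ (θ a)`, that is 0110 or 1001, and its middle
    -- letters agree.
    t-equal : t (1 + m * 2 * 2) ≡ t (2 + m * 2 * 2)
    t-equal = begin
      t (1 + m * 2 * 2)  ≡⟨ t-odd (m * 2) ⟩
      not (t (m * 2))    ≡⟨ cong not (t-even m) ⟩
      not (t m)          ≡⟨ t-odd m ⟨
      t (1 + m * 2)      ≡⟨ t-even (1 + m * 2) ⟨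
      t (2 + m * 2 * 2)  ∎
      where open ≡-Reasoning

    reading₀ : t (1 + m * 2 * 2) xor t (u + q) ≡ c
    reading₀ = subst (λ x → t x xor t (u + q) ≡ c) u+r≡
      (before-wrap u (subst (_< 4 + m * 2 * 2) (sym u+r≡) (m≤n+m (2 + m * 2 * 2) 2)))

    reading₁ : t (2 + m * 2 * 2) xor t (1 + (u + q)) ≡ c
    reading₁ = subst (λ x → t (1 + x) xor t (1 + (u + q)) ≡ c) u+r≡
      (before-wrap (1 + u) (subst (λ x → 1 + x < 4 + m * 2 * 2) (sym u+r≡) (m≤n+m (3 + m * 2 * 2) 1)))

    before : t (u + q) ≡ t (1 + (u + q))
    before = xor-cancelˡ (t (1 + m * 2 * 2))
      (trans reading₀ (trans (sym reading₁) (cong (_xor _) (sym t-equal))))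

    after : t (5 + (u + q)) ≡ t (6 + (u + q))
    after = not-injective (trans
      (after-wrap 1 (m≤m+n 2 _) (s≤s (m≤n⇒m≤1+n (s≤s 3+u≤N))))
      (sym (after-wrap 2 (m≤m+n 3 _) (s≤s (s≤s (s≤s 3+u≤N))))))

    by-parity : ∀ x → (∃[ p ] x ≡ p * 2) ⊎ (∃[ p ] x ≡ 1 + p * 2) →
                t x ≡ t (1 + x) → t (5 + x) ≡ t (6 + x) → ⊥
    by-parity _ (inj₁ (p , refl)) before _    = t-even-pair p before
    by-parity _ (inj₂ (p , refl)) _     after = t-even-pair (3 + p) after

  -- `pair` comes from `v 1 = v 2` and makes `q` even. The two terms after the second wrap exclude 2
  -- modulo 4, and terms around or after the first wrap exclude 0.
  wrap-not-at-1 : Long (3 + m * 2 * 2) → ⊥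
  wrap-not-at-1 long = by-parity (parity q)
    where
    open Readings (4 + m * 2 * 2) (3 + m * 2 * 2) 1 q c refl split long

    pair : t (3 + q) ≡ t (4 + q)
    pair = not-injective (trans (after-wrap 1 (m≤m+n 2 _) (m≤m+n 3 _))
                           (sym (after-wrap 2 (m≤m+n 3 _) (m≤m+n 4 _))))

    overhang : t (7 + (m * 2 * 2 + q)) ≡ not (t (8 + (m * 2 * 2 + q)))
    overhang = trans (after-second-wrap 0 (m≤m+n 1 _) (m≤m+n 2 _))
                (sym (after-second-wrap 1 (m≤m+n 2 _) (m≤m+n 3 _)))

    q≢2mod4 : ∀ s → q ≢ 2 + s * 2 * 2
    q≢2mod4 s refl = t-even-pair (2 + (m + s)) (not-injective (begin
      not (t (4 + (m + s) * 2))        ≡⟨ t-odd (4 + (m + s) * 2) ⟨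
      t (9 + (m + s) * 2 * 2)          ≡⟨ cong (λ x → t (7 + x)) shift ⟨
      t (7 + (m * 2 * 2 + q))          ≡⟨ overhang ⟩
      not (t (8 + (m * 2 * 2 + q)))    ≡⟨ cong (λ x → not (t (8 + x))) shift ⟩
      not (t (10 + (m + s) * 2 * 2))   ≡⟨ cong not (t-even (5 + (m + s) * 2)) ⟩
      not (t (5 + (m + s) * 2))        ∎))
      where
      open ≡-Reasoning
      shift : m * 2 * 2 + (2 + s * 2 * 2) ≡ 2 + (m + s) * 2 * 2
      shift = solve (m ∷ s ∷ [])

    q≢0mod4 : ∀ m′ → m ≡ m′ → ∀ s → q ≢ s * 2 * 2
    -- For `N = 4` no remainder 4 exists; instead the terms on either side of the wrap are compared,
    -- using `v 3 = v 0 = 0`.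
    q≢0mod4 zero refl s refl = t-even-pair s (begin
      t (s * 2)           ≡⟨ t-even (s * 2) ⟨
      t (s * 2 * 2)       ≡⟨ before-wrap 0 ≤-refl ⟩
      c                   ≡⟨ after-wrap 0 (m≤m+n 1 3) (m≤m+n 2 5) ⟨
      t (2 + s * 2 * 2)   ≡⟨ t-even (1 + s * 2) ⟩
      t (1 + s * 2)       ∎)
      where open ≡-Reasoning
    -- Here `v 2 = v 4 = 1`, and the quotients `4 + q` and `6 + q` halve to an even pair.
    q≢0mod4 (suc _) refl s refl = t-even-pair (1 + s) (begin
      t (2 + s * 2)       ≡⟨ t-even (2 + s * 2) ⟨
      t (4 + s * 2 * 2)   ≡⟨ not-injective (trans (after-wrap 2 (m≤m+n 3 _) (m≤m+n 4 _))
                                              (sym (after-wrap 4 (m≤m+n 5 _) (m≤m+n 6 _)))) ⟩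
      t (6 + s * 2 * 2)   ≡⟨ t-even (3 + s * 2) ⟩
      t (3 + s * 2)       ∎)
      where open ≡-Reasoning

    by-parity : (∃[ p ] q ≡ p * 2) ⊎ (∃[ p ] q ≡ 1 + p * 2) → ⊥
    by-parity (inj₂ (p , refl)) = t-even-pair (2 + p) pair
    by-parity (inj₁ (p , q≡)) with parity p
    ... | inj₁ (s , refl) = q≢0mod4 m refl s q≡
    ... | inj₂ (s , refl) = q≢2mod4 s q≡

  -- Now `pair` makes `q` odd. The two terms before the wrap have remainders `N - 2` and `N - 1`,
  -- whose letters differ, which excludes 1 modulo 4; later terms exclude 3.
  wrap-not-at-2 : Long (2 + m * 2 * 2) → ⊥
  wrap-not-at-2 long = by-parity (parity q)
    where
    open Readings (4 + m * 2 * 2) (2 + m * 2 * 2) 2 q c refl split long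

    pair : t (4 + q) ≡ t (5 + q)
    pair = not-injective (trans (after-wrap 1 (m≤m+n 2 _) (m≤m+n 4 _))
                           (sym (after-wrap 2 (m≤m+n 3 _) (m≤m+n 5 _))))

    overhang : t q ≡ not (t (1 + q))
    overhang = xor-cancelˡ-not (t (2 + m * 2 * 2)) (begin
      t (2 + m * 2 * 2) xor t q              ≡⟨ before-wrap 0 (m≤n+m (3 + m * 2 * 2) 1) ⟩
      c                                      ≡⟨ before-wrap 1 ≤-refl ⟨
      t (3 + m * 2 * 2) xor t (1 + q)        ≡⟨ cong (_xor t (1 + q)) (t-odd (1 + m * 2)) ⟩
      not (t (1 + m * 2)) xor t (1 + q)      ≡⟨ cong (λ b → not b xor t (1 + q)) (t-even (1 + m * 2)) ⟨
      not (t (2 + m * 2 * 2)) xor t (1 + q)  ∎)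
      where open ≡-Reasoning

    q≢1mod4 : ∀ s → q ≢ 1 + s * 2 * 2
    q≢1mod4 s refl = t-even-pair s (not-injective (begin
      not (t (s * 2))          ≡⟨ t-odd (s * 2) ⟨
      t (1 + s * 2 * 2)        ≡⟨ overhang ⟩
      not (t (2 + s * 2 * 2))  ≡⟨ cong not (t-even (1 + s * 2)) ⟩
      not (t (1 + s * 2))      ∎))
      where open ≡-Reasoning

    q≢3mod4 : ∀ m′ → m ≡ m′ → ∀ s → q ≢ 3 + s * 2 * 2
    -- For `N = 4` the single term after the second wrap replaces the missing remainder 4.
    q≢3mod4 zero refl s refl = t-even-pair (2 + s) (not-injective (begin
      not (t (4 + s * 2))      ≡⟨ cong not (t-even (4 + s * 2)) ⟨
      not (t (8 + s * 2 * 2))  ≡⟨ after-wrap 2 (m≤m+n 3 1) (m≤m+n 5 2) ⟩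
      c                        ≡⟨ after-second-wrap 0 (m≤m+n 1 3) (m≤m+n 3 0) ⟨
      t (11 + s * 2 * 2)       ≡⟨ t-odd (5 + s * 2) ⟩
      not (t (5 + s * 2))      ∎))
      where open ≡-Reasoning
    q≢3mod4 (suc _) refl s refl = t-even-pair (2 + s) (begin
      t (4 + s * 2)       ≡⟨ t-even (4 + s * 2) ⟨
      t (8 + s * 2 * 2)   ≡⟨ not-injective (trans (after-wrap 2 (m≤m+n 3 _) (m≤m+n 5 _))
                                              (sym (after-wrap 4 (m≤m+n 5 _) (m≤m+n 7 _)))) ⟩
      t (10 + s * 2 * 2)  ≡⟨ t-even (5 + s * 2) ⟩
      t (5 + s * 2)       ∎)
      where open ≡-Reasoning

    by-parity : (∃[ p ] q ≡ p * 2) ⊎ (∃[ p ] q ≡ 1 + p * 2) → ⊥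
    by-parity (inj₁ (p , refl)) = t-even-pair (2 + p) pair
    by-parity (inj₂ (p , q≡)) with parity p
    ... | inj₁ (s , refl) = q≢1mod4 s q≡
    ... | inj₂ (s , refl) = q≢3mod4 m refl s q≡

  no-long-progression : ∀ r → r < 4 + m * 2 * 2 → Long r → ⊥
  no-long-progression r r<N = by-wrap (4 + m * 2 * 2 ∸ r) r r<N (m∸n+n≡m (<⇒≤ r<N))
    where
    by-wrap : ∀ s r → r < 4 + m * 2 * 2 → s + r ≡ 4 + m * 2 * 2 → Long r → ⊥
    by-wrap 0 r r<N eq = ⊥-elim (<⇒≢ r<N eq)
    by-wrap 1 _ _ refl = wrap-not-at-1
    by-wrap 2 _ _ refl = wrap-not-at-2
    by-wrap (suc (suc (suc u))) r _ eq = wrap-not-at-3+ u r eq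

-- Lower bound: an explicit progression

long-progression : ∀ m → SplitsAt (4 + m * 2 * 2) →
  ∃[ i ] (∀ k → k < 6 + m * 2 * 2 → t (i + k * (5 + m * 2 * 2)) ≡ true)
long-progression m split = 3 + R + q * N , mono
  where
  -- Steps 1, …, N are governed by the letter v 4; since v 3, v 4, v 5 = 0, 1, 0,
  -- the progression extends by one term on either side.
  R = m * 2 * 2
  N = 4 + R
  q = 2 + R + 3 * N

  open ≡-Reasoning

  inside : ∀ R j → 3 + R + (2 + R + 3 * (4 + R)) * (4 + R) + suc j * (5 + R) ≡
                   j + (j + 4 * (4 + R)) * (4 + R)
  inside R j = solve (R ∷ j ∷ [])

  after : ∀ R → 3 + R + (2 + R + 3 * (4 + R)) * (4 + R) + (5 + R) * (5 + R) ≡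
                0 + (1 + 5 * (4 + R)) * (4 + R)
  after R = solve (R ∷ [])

  mono : ∀ k → k < 2 + N → t (3 + R + q * N + k * (1 + N)) ≡ true
  -- Since `q = (N - 2) + 3 * N` and `v 3 = 0`, the term compares the differing letters at `N - 1`
  -- and `N - 2`.
  mono zero _ = begin
    t (3 + R + q * N + 0)              ≡⟨ cong t (+-identityʳ (3 + R + q * N)) ⟩
    t (3 + R + q * N)                  ≡⟨ split (3 + R) q ≤-refl ⟩
    t (3 + R) xor t q                  ≡⟨ cong (_xor t q) (t-odd (1 + m * 2)) ⟩
    not (t (1 + m * 2)) xor t q        ≡⟨ cong (λ b → not b xor t q) (t-even (1 + m * 2)) ⟨
    not (t (2 + R)) xor t q            ≡⟨ cong (not (t (2 + R)) xor_) (split (2 + R) 3 (m≤n+m (3 + R) 1)) ⟩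
    not (t (2 + R)) xor (t (2 + R) xor false)  ≡⟨ not-distribˡ-xor (t (2 + R)) _ ⟨
    not (t (2 + R) xor (t (2 + R) xor false))  ≡⟨ cong not (xor-xor-cancelˡ (t (2 + R)) false) ⟩
    true                               ∎
  mono (suc j) (s≤s j<1+N) with m≤n⇒m<n∨m≡n (s≤s⁻¹ j<1+N)
  -- Remainder `j` meets quotient `j + 4 * N`, so the two copies of `t j` cancel and `t 4` remains.
  ... | inj₁ j<N = begin
    t (3 + R + q * N + suc j * (1 + N))  ≡⟨ cong t (inside R j) ⟩
    t (j + (j + 4 * N) * N)              ≡⟨ split j (j + 4 * N) j<N ⟩
    t j xor t (j + 4 * N)                ≡⟨ cong (t j xor_) (split j 4 j<N) ⟩
    t j xor (t j xor true)               ≡⟨ xor-xor-cancelˡ (t j) true ⟩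
    true                                 ∎
  -- After the second wrap the remainder is 0, and the quotient `1 + 5 * N` contributes
  -- `t 1 xor t 5`.
  ... | inj₂ refl = begin
    t (3 + R + q * N + (1 + N) * (1 + N))  ≡⟨ cong t (after R) ⟩
    t (0 + (1 + 5 * N) * N)                ≡⟨ split 0 (1 + 5 * N) (m≤m+n 1 _) ⟩
    t (1 + 5 * N)                          ≡⟨ split 1 5 (m≤m+n 2 _) ⟩
    true                                   ∎

-- The exact maximum and its specialisation to powers of two

max-progression : ∀ m → SplitsAt (4 + m * 2 * 2) → A[ 5 + m * 2 * 2 ]= (6 + m * 2 * 2)
max-progression m split = (m≤m+n 1 _ , exists (long-progression m split)) , bounded
  where
  N = 4 + m * 2 * 2

  exists : ∃[ i ] (∀ k → k < 2 + N → t (i + k * (1 + N)) ≡ true) →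
           MonochromaticAP (1 + N) (2 + N)
  exists (i , mono) = i , λ k k< → bit-injective (begin
    t (i + k * (1 + N))  ≡⟨ mono k k< ⟩
    true                 ≡⟨ mono 0 (m≤m+n 1 _) ⟨
    t (i + 0)            ≡⟨ cong t (+-identityʳ i) ⟩
    t i                  ∎)
    where open ≡-Reasoning

  bounded : ∀ L → 1 ≤ L → MonochromaticAP (1 + N) L → L ≤ 2 + N
  bounded L _ (i , mono) = ≮⇒≥ λ 2+N<L →
    no-long-progression m (i / N) (t i) split (i % N) (m%n<n i N) λ k k<3+N → begin
      t (i % N + i / N * N + k * (1 + N))  ≡⟨ cong (λ x → t (x + k * (1 + N))) (m≡m%n+[m/n]*n i N) ⟨
      t (i + k * (1 + N))                  ≡⟨ cong bit (mono k (<-≤-trans k<3+N 2+N<L)) ⟩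
      t i                                  ∎
    where open ≡-Reasoning

4∣2^ : ∀ n → n > 1 → ∃[ m ] 2 ^ n ≡ 4 + m * 2 * 2
4∣2^ (suc (suc n)) _ with 2 ^ n | m^n>0 2 n
... | suc m | _ = m , solve (m ∷ [])
4∣2^ 1 (s≤s ())

proposition16 : (n : ℕ) → n > 1 → A[ 2 ^ n + 1 ]= (2 ^ n + 2)
proposition16 n n>1 with 4∣2^ n n>1
... | m , 2^n≡ = subst₂ A[_]=_
  (trans (cong (1 +_) (sym 2^n≡)) (+-comm 1 (2 ^ n)))
  (trans (cong (2 +_) (sym 2^n≡)) (+-comm 2 (2 ^ n)))
  (max-progression m (subst SplitsAt 2^n≡ (t-split n)))
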